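{- Consider the edge-weighted variant of online degree-bounded Steiner tree. There is an absolute constant $c>0$ such that for arbitrarily large $n$ and every (possibly randomized) online algorithm $\mathcal{A}$, there exist an instance on $n$ vertices with a degree bound $b$ and a request sequence such that either $\mathbb{E}[\operatorname{maxdegree}(\mathcal{A})]\ge c\,n\cdot b$ or $\mathbb{E}[\operatorname{weight}(\mathcal{A})]\ge c\,n\cdot\mathrm{OPT}_b$; i.e., either $\mathbb{E}[\operatorname{maxdegree}(\mathcal{A})]\ge\Omega(n)\cdot b$ or $\mathbb{E}[\operatorname{weight}(\mathcal{A})]\ge\Omega(n)\cdot\mathrm{OPT}_b$.
   Context: Edge-weighted online degree-bounded Steiner tree: an undirected graph $G$ with nonnegative edge weights, a root vertex, and a degree bound $b$ are given in advance; terminals arrive one by one, and after each arrival the online algorithm must add edges (never removing any) so that all terminals so far are connected to the root. $\operatorname{maxdegree}(\mathcal{A})$ and $\operatorname{weight}(\mathcal{A})$ are the maximum vertex degree and total edge weight of the final subgraph produced by $\mathcal{A}$; $\mathrm{OPT}_b$ is the minimum weight of a Steiner tree connecting all requested terminals to the root with maximum degree at most $b$. Expectations are over the randomness of $\mathcal{A}$. -}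

module Defs where

open import Level using (Level; _⊔_) renaming (suc to lsuc)
open import Algebra.Bundles using (CommutativeRing)
import Algebra.Definitions.RawMonoid as RawMonoidDefs
open import Data.Bool.Base using (if_then_else_; _∨_)
open import Data.Fin.Base as Fin using (Fin)
open import Data.Fin.Properties as Fin using ()
open import Data.Fin.Subset using (Subset; _∈_; _∩_; _∪_; ⊤; ⋃; ∣_∣)
open import Data.List.Base using (List; []; _∷_; [_]; _++_; map; length; allFin)
open import Data.List.Extrema.Nat using (max)
open import Data.List.Relation.Unary.All using (All)
open import Data.List.Relation.Unary.Linked using (Linked)
open import Data.List.Relation.Unary.Unique.Propositional using (Unique)
open import Data.Nat.Base as ℕ using (ℕ)
open import Data.Product.Base using (_×_; _,_; proj₁; proj₂; ∃-syntax)
open import Data.Sum.Base using (_⊎_)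
open import Data.Vec.Base using (lookup; tabulate)
open import Data.Vec.Functional using (Vector)
open import Function.Definitions using (Injective)
open import Relation.Binary.Core using (Rel)
open import Relation.Binary.Construct.Closure.ReflexiveTransitive using (Star)
open import Relation.Binary.PropositionalEquality.Core using (_≡_)
open import Relation.Binary.Structures using (IsTotalOrder)
open import Relation.Nullary.Decidable.Core using (does)
open import Relation.Nullary.Negation.Core using (¬_)

-- Stands in for the real numbers, which the standard library lacks: weights,
-- probabilities and expectations take values in an arbitrary linearly ordered
-- field.
record LinearlyOrderedField (k ℓ₁ ℓ₂ : Level) : Set (lsuc (k ⊔ ℓ₁ ⊔ ℓ₂)) where
  field
    commutativeRing : CommutativeRing k ℓ₁
  open CommutativeRing commutativeRing public
  infix 4 _≤_ _<_
  field
    _≤_          : Rel Carrier ℓ₂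
    isTotalOrder : IsTotalOrder _≈_ _≤_
    0≉1          : ¬ (0# ≈ 1#)
    inverse      : ∀ x → ¬ (x ≈ 0#) → ∃[ y ] x * y ≈ 1#
    +-monoˡ-≤    : ∀ z {x y} → x ≤ y → x + z ≤ y + z
    *-nonNeg     : ∀ {x y} → 0# ≤ x → 0# ≤ y → 0# ≤ x * y

  _<_ : Rel Carrier (ℓ₁ ⊔ ℓ₂)
  x < y = x ≤ y × ¬ (x ≈ y)

  open RawMonoidDefs +-rawMonoid public using (sum) renaming (_×_ to _·_)

  fromℕ : ℕ → Carrier
  fromℕ n = n · 1#

-- A finite simple undirected graph on the vertex set Fin n.  The unordered
-- pair {u , v} is represented by (u , v) with u < v, so `increasing` excludes
-- loops and `distinct` excludes parallel edges.
record Graph (n : ℕ) : Set where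
  field
    size       : ℕ
    ends       : Fin size → Fin n × Fin n
    increasing : ∀ e → proj₁ (ends e) Fin.< proj₂ (ends e)
    distinct   : Injective _≡_ _≡_ ends

  EdgeSet : Set
  EdgeSet = Subset size

  Adjacent : EdgeSet → Rel (Fin n) _
  Adjacent S u v = ∃[ e ] e ∈ S × (ends e ≡ (u , v) ⊎ ends e ≡ (v , u))

  Connected : EdgeSet → Rel (Fin n) _
  Connected S = Star (Adjacent S)

  incident : Fin n → EdgeSet
  incident v = tabulate λ e →
    does (v Fin.≟ proj₁ (ends e)) ∨ does (v Fin.≟ proj₂ (ends e))

  degree : EdgeSet → Fin n → ℕ
  degree S v = ∣ S ∩ incident v ∣

  maxDegree : EdgeSet → ℕ
  maxDegree S = max 0 (map (degree S) (allFin n))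

  -- v ∷ vs is the list of the (at least three, pairwise distinct) vertices of
  -- a cycle, in cyclic order.
  IsCycle : EdgeSet → Fin n → List (Fin n) → Set
  IsCycle S v vs =
    2 ℕ.≤ length vs × Unique (v ∷ vs) × Linked (Adjacent S) (v ∷ vs ++ [ v ])

  Acyclic : EdgeSet → Set
  Acyclic S = ∀ v vs → ¬ IsCycle S v vs

  -- The vertices of the subgraph S are the root and the endpoints of the edges
  -- in S; `spans` says that this subgraph is connected.
  record IsSteinerTree (root : Fin n) (terminals : List (Fin n)) (S : EdgeSet) : Set where
    field
      connects : All (Connected S root) terminals
      spans    : ∀ e → e ∈ S → Connected S root (proj₁ (ends e))
      acyclic  : Acyclic S

module Online {k ℓ₁ ℓ₂} (K : LinearlyOrderedField k ℓ₁ ℓ₂) where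

  open LinearlyOrderedField K

  record Instance (n : ℕ) : Set (k ⊔ ℓ₂) where
    field
      graph      : Graph n
    open Graph graph public
    field
      edgeWeight : Fin size → Carrier
      nonNeg     : ∀ e → 0# ≤ edgeWeight e
      root       : Fin n
      bound      : ℕ

    weight : EdgeSet → Carrier
    weight S = sum λ e → if lookup S e then edgeWeight e else 0#

    -- What is known after some arrivals: the requested terminals, each with the
    -- edges added in response to it, latest first.
    History : Set
    History = List (Fin n × EdgeSet)

    bought : History → EdgeSet
    bought h = ⋃ (map proj₂ h)

    record IsFeasible (terminals : List (Fin n)) (S : EdgeSet) : Set where
      field
        isSteinerTree : IsSteinerTree root terminals S
        degreeBounded : maxDegree S ℕ.≤ bound

    record IsOPT (terminals : List (Fin n)) (opt : Carrier) : Set (ℓ₁ ⊔ ℓ₂) where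
      field
        attained : ∃[ S ] IsFeasible terminals S × weight S ≈ opt
        minimum  : ∀ S → IsFeasible terminals S → opt ≤ weight S

  -- Finitely supported probability distributions.
  record Distribution {a} (A : Set a) : Set (a ⊔ k ⊔ ℓ₁ ⊔ ℓ₂) where
    field
      support  : ℕ
      outcome  : Vector A support
      prob     : Vector Carrier support
      positive : ∀ i → 0# < prob i
      total    : sum prob ≈ 1#

    expectation : (A → Carrier) → Carrier
    expectation f = sum λ i → prob i * f (outcome i)

  open Instance

  -- A randomized online algorithm knows the instance in advance.  When terminal
  -- t arrives after the history h, it draws at random the set of edges to add;
  -- the law of this set may depend on the instance, on h and on t.  Deterministic
  -- algorithms are those all of whose distributions have support of size 1.
  -- A terminal which is not connected to the root even in the whole graph
  -- cannot be served, and imposes no obligation.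
  record OnlineAlgorithm : Set (k ⊔ ℓ₁ ⊔ ℓ₂) where
    field
      choose : ∀ {n} (I : Instance n) → History I → Fin n → Distribution (EdgeSet I)
      serves : ∀ {n} (I : Instance n) h t → Connected I ⊤ (root I) t →
               ∀ i → Connected I (Distribution.outcome (choose I h t) i ∪ bought I h) (root I) t

  -- Expected value of f at the final set of bought edges, when the terminals of
  -- the list arrive in order after the history h.
  expectedFrom : OnlineAlgorithm → ∀ {n} (I : Instance n) →
                 History I → List (Fin n) → (EdgeSet I → Carrier) → Carrier
  expectedFrom A I h []       f = f (bought I h)
  expectedFrom A I h (t ∷ ts) f =
    Distribution.expectation (OnlineAlgorithm.choose A I h t) λ S →
      expectedFrom A I ((t , S) ∷ h) ts f

  𝔼[maxDegree] : OnlineAlgorithm → ∀ {n} → Instance n → List (Fin n) → Carrier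
  𝔼[maxDegree] A I σ = expectedFrom A I [] σ λ S → fromℕ (maxDegree I S)

  𝔼[weight] : OnlineAlgorithm → ∀ {n} → Instance n → List (Fin n) → Carrier
  𝔼[weight] A I σ = expectedFrom A I [] σ (weight I)

{-# OPTIONS --safe #-}
module Submission where

-- The hard instance is a fan: the root is joined to the terminals 0 , … , p by spokes
-- of weight 0, and terminals j and j + 1 are joined by a link of weight Q ^ j with
-- Q large; the degree bound is 2.  The terminals are requested in order.  After the
-- request of terminal k + 1, the optimum uses the spoke of terminal k + 1 and the path
-- root , 0 , … , k, so it costs at most Q ^ k / n, whereas an algorithm which did
-- not buy that spoke has paid at least Q ^ k for a link.  So if some spoke is bought
-- with probability at most 1/2 when its terminal is requested, the adversary stops
-- there and the expected weight is too large; otherwise all requests are made, and the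
-- expected degree of the root is about n / 2.

open import Defs
import Algebra.Properties.CommutativeSemigroup as CommutativeSemigroupProperties
import Algebra.Properties.Ring as RingProperties
import Algebra.Properties.Semiring.Mult as MultProperties
import Algebra.Properties.Semiring.Sum as SumProperties
open import Data.Bool.Base using (true; false; if_then_else_)
open import Data.Empty using (⊥; ⊥-elim)
open import Data.Fin.Base as Fin using (Fin; zero; suc; toℕ; fromℕ<; inject₁; splitAt; join; _↑ˡ_; _↑ʳ_)
import Data.Fin.Properties as Fin
open import Data.Fin.Subset using (Subset; ⊤; inside; outside; _∈_; _∉_; _⊆_; _∩_; _∪_; _-_; ∣_∣)
open import Data.Fin.Subset.Properties using (_∈?_; ∈⊤; q⊆p∪q; p⊂q⇒∣p∣<∣q∣; x∈p∩q⁺; x∈p∩q⁻; p⊆q⇒∣p∣≤∣q∣; x∈p∧x≢y⇒x∈p-y; x∈p⇒∣p-x∣<∣p∣)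
open import Data.List.Base using (List; []; _∷_; [_]; _++_; map; allFin)
open import Data.List.Extrema.Nat using (max≤v⁺; xs≤max)
open import Data.List.Membership.Propositional.Properties using (∈-allFin)
open import Data.List.Relation.Unary.All as All using (All; []; _∷_)
import Data.List.Relation.Unary.All.Properties as All
open import Data.List.Relation.Unary.AllPairs using (_∷_)
open import Data.List.Relation.Unary.Linked using (Linked; _∷_)
open import Data.List.Relation.Unary.Unique.Propositional using (Unique)
open import Data.Nat.Base as ℕ using (ℕ; zero; suc; z≤n; s≤s)
import Data.Nat.Properties as ℕ
open import Data.Product.Base using (_×_; _,_; proj₁; proj₂; Σ-syntax; ∃-syntax)
open import Data.Product.Properties using (,-injective)
open import Data.Sum.Base using (_⊎_; inj₁; inj₂; [_,_]′; swap)
open import Data.Vec.Base using (_∷_; here; there; tabulate; lookup)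
open import Data.Vec.Functional using (Vector)
open import Data.Vec.Properties using (lookup∘tabulate; []=⇒lookup; lookup⇒[]=)
open import Function.Base using (_∘_; flip)
open import Function.Definitions using (Injective)
open import Level using (Level; 0ℓ; _⊔_)
open import Relation.Binary.Bundles using (Poset)
open import Relation.Binary.Construct.Closure.ReflexiveTransitive using (ε; _◅_; _◅◅_)
open import Relation.Binary.Core using (Rel)
open import Relation.Binary.PropositionalEquality using (_≡_; _≢_; refl; sym; trans; cong; cong₂; subst; module ≡-Reasoning)
import Relation.Binary.Reasoning.PartialOrder as ≤-Reasoning
open import Relation.Binary.Structures using (IsTotalOrder)
open import Relation.Nullary.Decidable using (yes; no; does; dec-true; _×-dec_; _⊎-dec_)
open import Relation.Nullary.Negation using (¬_; contradiction)
open import Relation.Unary using (Pred; Decidable)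

-- Finite subsets

select : ∀ {s} {P : Pred (Fin s) 0ℓ} → Decidable P → Subset s
select P? = tabulate (does ∘ P?)

module _ {s : ℕ} {P : Pred (Fin s) 0ℓ} (P? : Decidable P) where

  ∈-select⁺ : ∀ {x} → P x → x ∈ select P?
  ∈-select⁺ {x} px =
    lookup⇒[]= x _ (trans (lookup∘tabulate (does ∘ P?) x) (dec-true (P? x) px))

  ∈-select⁻ : ∀ {x} → x ∈ select P? → P x
  ∈-select⁻ {x} x∈ with P? x | trans (sym (lookup∘tabulate (does ∘ P?) x)) ([]=⇒lookup x∈)
  ... | yes px | _ = px

-- Turns bounds on `∣ T ∣` into the pigeonhole principle for `Fin`.
enumerate : ∀ {s} (T : Subset s) → Fin ∣ T ∣ → Fin s
enumerate (inside  ∷ T) zero    = zero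
enumerate (inside  ∷ T) (suc i) = suc (enumerate T i)
enumerate (outside ∷ T) i       = suc (enumerate T i)

enumerate-∈ : ∀ {s} (T : Subset s) i → enumerate T i ∈ T
enumerate-∈ (inside  ∷ T) zero    = here
enumerate-∈ (inside  ∷ T) (suc i) = there (enumerate-∈ T i)
enumerate-∈ (outside ∷ T) i       = there (enumerate-∈ T i)

enumerate-injective : ∀ {s} (T : Subset s) → Injective _≡_ _≡_ (enumerate T)
enumerate-injective (inside  ∷ T) {zero}  {zero}  _  = refl
enumerate-injective (inside  ∷ T) {suc i} {suc j} eq =
  cong suc (enumerate-injective T (Fin.suc-injective eq))
enumerate-injective (outside ∷ T) eq = enumerate-injective T (Fin.suc-injective eq)

injectiveOn⇒∣∣≤ : ∀ {s k} (T : Subset s) (g : Fin s → Fin k) →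
                  (∀ {x y} → x ∈ T → y ∈ T → g x ≡ g y → x ≡ y) → ∣ T ∣ ℕ.≤ k
injectiveOn⇒∣∣≤ T g g-inj = Fin.injective⇒≤ {f = g ∘ enumerate T} λ {i} {j} eq →
  enumerate-injective T (g-inj (enumerate-∈ T i) (enumerate-∈ T j) eq)

-- Graphs

-- A cycle that starts along R can never turn back, so it ascends forever.
module Ascent {n : ℕ} {Adj R _≺_ : Rel (Fin n) 0ℓ}
  (orient : ∀ {u v} → Adj u v → R u v ⊎ R v u)
  (cofunctional : ∀ {u v x} → R u x → R v x → u ≡ v)
  (R⇒≺ : ∀ {u v} → R u v → u ≺ v)
  (≺-trans : ∀ {u v w} → u ≺ v → v ≺ w → u ≺ w) where

  onward : ∀ {u x y} → R u x → Adj x y → u ≢ y → R x y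
  onward Rux Axy u≢y with orient Axy
  ... | inj₁ Rxy = Rxy
  ... | inj₂ Ryx = contradiction (cofunctional Rux Ryx) u≢y

  -- Invariant of the traversal: `z` is the start of the cycle, `u` and `x` are the last two
  -- vertices visited, and `xs` are still to come.
  climb : ∀ {u x z} xs → R u x → Unique (z ∷ u ∷ x ∷ xs) →
          Linked Adj (x ∷ xs ++ [ z ]) → x ≺ z
  climb []       Rux ((z≢u ∷ _) ∷ _) (Axz ∷ _) = R⇒≺ (onward Rux Axz (z≢u ∘ sym))
  climb (y ∷ ys) Rux ((_ ∷ z≢) ∷ (_ ∷ u≢y ∷ _) ∷ unique) (Axy ∷ linked) =
    let Rxy = onward Rux Axy u≢y
    in ≺-trans (R⇒≺ Rxy) (climb ys Rxy (z≢ ∷ unique) linked)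

  -- `climb` requires the previous vertex to differ from the start of the cycle, so the first two
  -- edges are treated by hand.
  loop : ∀ {v x y} ys → R v x → Unique (v ∷ x ∷ y ∷ ys) →
         Linked Adj (x ∷ y ∷ ys ++ [ v ]) → v ≺ v
  loop ys Rvx unique@((_ ∷ v≢y ∷ _) ∷ _) (Axy ∷ linked) =
    let Rxy = onward Rvx Axy v≢y
    in ≺-trans (R⇒≺ Rvx) (≺-trans (R⇒≺ Rxy) (climb ys Rxy unique linked))

module _ {n : ℕ} (G : Graph n) where
  open Graph G

  incident? : ∀ v → Decidable λ e → v ≡ proj₁ (ends e) ⊎ v ≡ proj₂ (ends e)
  incident? v e = v Fin.≟ proj₁ (ends e) ⊎-dec v Fin.≟ proj₂ (ends e)

  ∈-incident⁺ : ∀ {v e} → v ≡ proj₁ (ends e) ⊎ v ≡ proj₂ (ends e) → e ∈ incident v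
  ∈-incident⁺ {v} = ∈-select⁺ (incident? v)

  ∈-incident⁻ : ∀ {v e} → e ∈ incident v → v ≡ proj₁ (ends e) ⊎ v ≡ proj₂ (ends e)
  ∈-incident⁻ {v} = ∈-select⁻ (incident? v)

  degree≤maxDegree : ∀ S v → degree S v ℕ.≤ maxDegree S
  degree≤maxDegree S v =
    All.lookup (All.map⁻ (xs≤max 0 (map (degree S) (allFin n)))) (∈-allFin v)

  maxDegree≤ : ∀ {S b} → (∀ v → degree S v ℕ.≤ b) → maxDegree S ℕ.≤ b
  maxDegree≤ deg≤ = max≤v⁺ z≤n (All.map⁺ (All.universal deg≤ (allFin n)))

  crossing : ∀ {S u v} {P : Pred (Fin n) 0ℓ} → Decidable P →
             Connected S u v → ¬ P u → P v →
             ∃[ x ] ∃[ y ] Adjacent S x y × ¬ P x × P y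
  crossing P? ε ¬Pu Pv = contradiction Pv ¬Pu
  crossing P? (_◅_ {j = w} a c) ¬Pu Pv with P? w
  ... | yes Pw = _ , _ , a , ¬Pu , Pw
  ... | no ¬Pw = crossing P? c ¬Pw Pv

  -- If `ρ` numbers the vertices and edges of `S` only join consecutive numbers, then `S` is part of
  -- a path. Both orientations are allowed because `ends` is ordered by vertex and not by rank.
  module LinearForest {S : EdgeSet} (ρ : Fin n → ℕ) (ρ-injective : Injective _≡_ _≡_ ρ)
    (consecutive : ∀ e → e ∈ S → ρ (proj₂ (ends e)) ≡ suc (ρ (proj₁ (ends e)))
                               ⊎ ρ (proj₁ (ends e)) ≡ suc (ρ (proj₂ (ends e)))) where

    Up Down : Rel (Fin n) 0ℓ
    Up u v = ρ v ≡ suc (ρ u)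
    Down = flip Up

    orient : ∀ {u v} → Adjacent S u v → Up u v ⊎ Down u v
    orient (e , e∈S , eq) with ends e | consecutive e e∈S
    orient (e , e∈S , inj₁ refl) | _ | up⊎down   = up⊎down
    orient (e , e∈S , inj₂ refl) | _ | inj₁ down = inj₂ down
    orient (e , e∈S , inj₂ refl) | _ | inj₂ up   = inj₁ up

    Up-cofunctional : ∀ {u v x} → Up u x → Up v x → u ≡ v
    Up-cofunctional p q = ρ-injective (ℕ.suc-injective (trans (sym p) q))

    Up-functional : ∀ {u v x} → Up x u → Up x v → u ≡ v
    Up-functional p q = ρ-injective (trans p (sym q))

    -- The first edge of a cycle fixes a direction. `Ascent` applies to `Up`, or to `Down` with the
    -- order reversed, and puts the rank of `v` strictly below itself.
    acyclic : Acyclic S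
    acyclic v (x ∷ y ∷ ys) (_ , unique , Avx ∷ linked) with orient Avx
    ... | inj₁ up = ℕ.<-irrefl refl
      (Ascent.loop {_≺_ = λ u v → ρ u ℕ.< ρ v} orient Up-cofunctional
        (ℕ.≤-reflexive ∘ sym) ℕ.<-trans ys up unique linked)
    ... | inj₂ down = ℕ.<-irrefl refl
      (Ascent.loop {_≺_ = λ u v → ρ v ℕ.< ρ u} (swap ∘ orient) Up-functional
        (ℕ.≤-reflexive ∘ sym) (flip ℕ.<-trans) ys down unique linked)
    acyclic v (x ∷ []) (s≤s () , _)

    low : Fin size → ℕ
    low e = ρ (proj₁ (ends e)) ℕ.⊓ ρ (proj₂ (ends e))

    low-up : ∀ {e} → Up (proj₁ (ends e)) (proj₂ (ends e)) → low e ≡ ρ (proj₁ (ends e))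
    low-up eq = ℕ.m≤n⇒m⊓n≡m (ℕ.<⇒≤ (ℕ.≤-reflexive (sym eq)))

    low-down : ∀ {e} → Down (proj₁ (ends e)) (proj₂ (ends e)) → low e ≡ ρ (proj₂ (ends e))
    low-down eq = ℕ.m≥n⇒m⊓n≡n (ℕ.<⇒≤ (ℕ.≤-reflexive (sym eq)))

    -- The two edges would have the same ends in opposite order, which `increasing` excludes.
    opposed : ∀ {e f} → Up (proj₁ (ends e)) (proj₂ (ends e)) →
              Down (proj₁ (ends f)) (proj₂ (ends f)) →
              ρ (proj₁ (ends e)) ≡ ρ (proj₂ (ends f)) → ⊥
    opposed {e} {f} p q eq = ℕ.<-asym (increasing e)
      (subst (λ (u , v) → u Fin.< v)
        (cong₂ _,_ (ρ-injective (trans q (trans (cong suc (sym eq)) (sym p)))) (ρ-injective (sym eq)))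
        (increasing f))

    -- The lower rank fixes both ends, as the other end has the next rank. Edges of equal
    -- orientation then coincide by `distinct`; opposite orientations are impossible by `opposed`.
    low-injective : ∀ {e f} → e ∈ S → f ∈ S → low e ≡ low f → e ≡ f
    low-injective {e} {f} e∈S f∈S eq with consecutive e e∈S | consecutive f f∈S
    ... | inj₁ p | inj₁ q =
      let b = trans (sym (low-up p)) (trans eq (low-up q))
      in distinct (cong₂ _,_ (ρ-injective b) (ρ-injective (trans p (trans (cong suc b) (sym q)))))
    ... | inj₂ p | inj₂ q =
      let b = trans (sym (low-down p)) (trans eq (low-down q))
      in distinct (cong₂ _,_ (ρ-injective (trans p (trans (cong suc b) (sym q)))) (ρ-injective b))
    ... | inj₁ p | inj₂ q =
      ⊥-elim (opposed {e} {f} p q (trans (sym (low-up p)) (trans eq (low-down q))))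
    ... | inj₂ p | inj₁ q =
      ⊥-elim (opposed {f} {e} q p (trans (sym (low-up q)) (trans (sym eq) (low-down p))))

    low-incident : ∀ {v e} → e ∈ S → e ∈ incident v → low e ≡ ρ v ⊎ suc (low e) ≡ ρ v
    low-incident {v} {e} e∈S e∈v with consecutive e e∈S | ∈-incident⁻ {v} {e} e∈v
    ... | inj₁ p | inj₁ refl = inj₁ (low-up p)
    ... | inj₁ p | inj₂ refl = inj₂ (trans (cong suc (low-up p)) (sym p))
    ... | inj₂ p | inj₁ refl = inj₂ (trans (cong suc (low-down p)) (sym p))
    ... | inj₂ p | inj₂ refl = inj₁ (low-down p)

    -- An edge at `v` leads to the next or to the previous rank. `side` records which, and this
    -- determines `low`.
    degree≤2 : ∀ v → degree S v ℕ.≤ 2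
    degree≤2 v = injectiveOn⇒∣∣≤ (S ∩ incident v) side side-injective
      where
      side : Fin size → Fin 2
      side e with low e ℕ.≟ ρ v
      ... | yes _ = zero
      ... | no  _ = suc zero

      side-injective : ∀ {x y} → x ∈ S ∩ incident v → y ∈ S ∩ incident v →
                       side x ≡ side y → x ≡ y
      side-injective {x} {y} x∈ y∈ eq
        with x∈p∩q⁻ S _ x∈ | x∈p∩q⁻ S _ y∈ | low x ℕ.≟ ρ v | low y ℕ.≟ ρ v
      ... | x∈S , _ | y∈S , _ | yes p | yes q = low-injective x∈S y∈S (trans p (sym q))
      ... | x∈S , x∈v | y∈S , y∈v | no ¬p | no ¬q
        with low-incident x∈S x∈v | low-incident y∈S y∈v
      ...   | inj₁ p | _      = contradiction p ¬p
      ...   | inj₂ _ | inj₁ q = contradiction q ¬q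
      ...   | inj₂ p | inj₂ q =
        low-injective x∈S y∈S (ℕ.suc-injective (trans p (sym q)))

-- The fan graph

module Fan (p : ℕ) where

  -- Vertex `zero` is the root and `suc j` is terminal `j`.
  V : Set
  V = Fin (2 ℕ.+ p)

  edges : ℕ
  edges = suc p ℕ.+ p

  spoke : Fin (suc p) → Fin edges
  spoke j = j ↑ˡ p

  link : Fin p → Fin edges
  link j = suc p ↑ʳ j

  edge-elim : ∀ {ℓ} (P : Fin edges → Set ℓ) →
              (∀ j → P (spoke j)) → (∀ j → P (link j)) → ∀ e → P e
  edge-elim P Pspoke Plink e with splitAt (suc p) e | Fin.join-splitAt (suc p) p e
  ... | inj₁ j | refl = Pspoke j
  ... | inj₂ j | refl = Plink j

  endpoints : Fin (suc p) ⊎ Fin p → V × V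
  endpoints (inj₁ j) = zero , suc j
  endpoints (inj₂ j) = suc (inject₁ j) , suc (suc j)

  endpoints-injective : Injective _≡_ _≡_ endpoints
  endpoints-injective {inj₁ i} {inj₁ j} eq =
    cong inj₁ (Fin.suc-injective (proj₂ (,-injective eq)))
  endpoints-injective {inj₂ i} {inj₂ j} eq =
    cong inj₂ (Fin.suc-injective (Fin.suc-injective (proj₂ (,-injective eq))))

  endpoints-increasing : ∀ x → proj₁ (endpoints x) Fin.< proj₂ (endpoints x)
  endpoints-increasing (inj₁ j) = s≤s z≤n
  endpoints-increasing (inj₂ j) = s≤s (s≤s (ℕ.≤-reflexive (Fin.toℕ-inject₁ j)))

  splitAt-injective : Injective _≡_ _≡_ (splitAt (suc p) {p})
  splitAt-injective {e} {f} eq =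
    trans (sym (Fin.join-splitAt (suc p) p e))
      (trans (cong (join (suc p) p) eq) (Fin.join-splitAt (suc p) p f))

  fan : Graph (2 ℕ.+ p)
  fan = record
    { size       = edges
    ; ends       = endpoints ∘ splitAt (suc p)
    ; increasing = endpoints-increasing ∘ splitAt (suc p)
    ; distinct   = splitAt-injective ∘ endpoints-injective
    }

  open Graph fan

  ends-spoke : ∀ j → ends (spoke j) ≡ (zero , suc j)
  ends-spoke j = cong endpoints (Fin.splitAt-↑ˡ (suc p) j p)

  ends-link : ∀ j → ends (link j) ≡ (suc (inject₁ j) , suc (suc j))
  ends-link j = cong endpoints (Fin.splitAt-↑ʳ (suc p) p j)

  spoke-injective : Injective _≡_ _≡_ spoke
  spoke-injective = Fin.↑ˡ-injective p _ _

  -- Terminals 0 , ... , r - 1, built by appending, so that a longer sequence extends a shorter one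
  -- by its last request. The bound is irrelevant, so lists do not depend on its proof.
  requests : ∀ r → .(r ℕ.≤ suc p) → List V
  requests zero    _   = []
  requests (suc r) r<m = requests r (ℕ.<⇒≤ r<m) ++ [ suc (fromℕ< r<m) ]

  requests⁺ : ∀ {ℓ} {P : Pred V ℓ} r .(r≤m : r ℕ.≤ suc p) →
              (∀ j → toℕ j ℕ.< r → P (suc j)) → All P (requests r r≤m)
  requests⁺ zero    _   _ = []
  requests⁺ (suc r) r<m Ps = All.++⁺
    (requests⁺ r _ λ j j<r → Ps j (ℕ.m<n⇒m<1+n j<r))
    (Ps (fromℕ< r<m) (s≤s (ℕ.≤-reflexive (Fin.toℕ-fromℕ< r<m))) ∷ [])

  requests⁻ : ∀ {ℓ} {P : Pred V ℓ} r .(r≤m : r ℕ.≤ suc p) → All P (requests r r≤m) →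
              ∀ j → toℕ j ℕ.< r → P (suc j)
  requests⁻ {P = P} (suc r) r<m Ps j j<1+r
    with toℕ j ℕ.≟ r | All.++⁻ (requests r _) Ps
  ... | no j≢r   | init , _   =
    requests⁻ r _ init j (ℕ.≤∧≢⇒< (ℕ.s≤s⁻¹ j<1+r) j≢r)
  ... | yes refl | _ , Pr ∷ [] = subst (P ∘ suc) (Fin.fromℕ<-toℕ j _) Pr

  Interval : ℕ → ℕ → Pred V 0ℓ
  Interval lo hi zero    = ⊥
  Interval lo hi (suc l) = lo ℕ.≤ toℕ l × toℕ l ℕ.≤ hi

  interval? : ∀ lo hi → Decidable (Interval lo hi)
  interval? lo hi zero    = no λ ()
  interval? lo hi (suc l) = lo ℕ.≤? toℕ l ×-dec toℕ l ℕ.≤? hi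

  SpokeWithin : EdgeSet → ℕ → ℕ → Set
  SpokeWithin S lo hi = ∃[ l ] spoke l ∈ S × lo ℕ.≤ toℕ l × toℕ l ℕ.≤ hi

  -- Only links and spokes lead into an interval of terminals, so if neither of its two
  -- boundary links is bought, a spoke must be.
  isolated⇒spoke : ∀ {S lo hi v} →
    (∀ j → link j ∈ S → suc (toℕ j) ≢ lo × toℕ j ≢ hi) →
    Connected S zero v → Interval lo hi v → SpokeWithin S lo hi
  isolated⇒spoke {S} {lo} {hi} isolated c v∈
    with x , y , (e , e∈S , eq) , x∉ , y∈ ← crossing fan (interval? lo hi) c (λ ()) v∈ =
    edge-elim (λ e → e ∈ S → ends e ≡ (x , y) ⊎ ends e ≡ (y , x) → SpokeWithin S lo hi)
      (λ j j∈S → via-spoke j j∈S x∉ y∈ ∘ map-ends (ends-spoke j))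
      (λ j j∈S → via-link j j∈S x∉ y∈ ∘ map-ends (ends-link j))
      e e∈S eq
    where
    map-ends : ∀ {a b xy yx : V × V} → a ≡ b → a ≡ xy ⊎ a ≡ yx → b ≡ xy ⊎ b ≡ yx
    map-ends refl eq = eq

    via-spoke : ∀ {x y} j → spoke j ∈ S → ¬ Interval lo hi x → Interval lo hi y →
                (zero , suc j) ≡ (x , y) ⊎ (zero , suc j) ≡ (y , x) → SpokeWithin S lo hi
    via-spoke j j∈S x∉ y∈ (inj₁ refl) = j , j∈S , y∈
    via-spoke j j∈S x∉ () (inj₂ refl)

    -- A link with one end in the interval that is not a boundary link has its other end there too,
    -- so it does not cross.
    via-link : ∀ {x y} j → link j ∈ S → ¬ Interval lo hi x → Interval lo hi y →
               (suc (inject₁ j) , suc (suc j)) ≡ (x , y) ⊎ (suc (inject₁ j) , suc (suc j)) ≡ (y , x) →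
               SpokeWithin S lo hi
    via-link j j∈S x∉ (lo≤ , ≤hi) (inj₁ refl) = contradiction
      (subst (λ l → lo ℕ.≤ l × l ℕ.≤ hi) (sym (Fin.toℕ-inject₁ j))
        (ℕ.s≤s⁻¹ (ℕ.≤∧≢⇒< lo≤ (proj₁ (isolated j j∈S) ∘ sym)) , ℕ.<⇒≤ ≤hi)) x∉
    via-link j j∈S x∉ (lo≤ , ≤hi) (inj₂ refl) = contradiction
      ( ℕ.m≤n⇒m≤1+n (subst (lo ℕ.≤_) (Fin.toℕ-inject₁ j) lo≤)
      , ℕ.≤∧≢⇒< (subst (ℕ._≤ hi) (Fin.toℕ-inject₁ j) ≤hi) (proj₂ (isolated j j∈S))) x∉

  -- Terminal `k + 1` alone is an interval with boundary links `k` and `k + 1`. If neither is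
  -- bought, only its own spoke can connect it.
  noSpoke⇒heavyLink : ∀ {S} k → Connected S zero (suc (suc k)) → spoke (suc k) ∉ S →
                       ∃[ j ] link j ∈ S × toℕ k ℕ.≤ toℕ j
  noSpoke⇒heavyLink {S} k c k∉S
    with Fin.any? (λ j → link j ∈? S ×-dec toℕ k ℕ.≤? toℕ j)
  ... | yes found = found
  ... | no ¬found
    with l , l∈S , k<l , l≤k ← isolated⇒spoke {S}
           {lo = suc (toℕ k)} {hi = suc (toℕ k)}
           (λ j j∈S →
               (λ eq → ¬found (j , j∈S , ℕ.≤-reflexive (sym (ℕ.suc-injective eq))))
             , (λ eq → ¬found (j , j∈S , ℕ.≤-trans (ℕ.n≤1+n _) (ℕ.≤-reflexive (sym eq)))))
           c (ℕ.≤-refl , ℕ.≤-refl)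
    = contradiction
        (subst (λ l → spoke l ∈ S) (Fin.toℕ-injective (ℕ.≤-antisym l≤k k<l)) l∈S) k∉S

  spoke-∈-incident : ∀ {S} j → spoke j ∈ S → spoke j ∈ S ∩ incident zero
  spoke-∈-incident j j∈S =
    x∈p∩q⁺ (j∈S , ∈-incident⁺ fan (inj₁ (sym (cong proj₁ (ends-spoke j)))))

  threeSpokes⇒3≤degree : ∀ {S a b c} → a ≢ b → a ≢ c → b ≢ c →
    spoke a ∈ S → spoke b ∈ S → spoke c ∈ S → 3 ℕ.≤ degree S zero
  threeSpokes⇒3≤degree {S} {a} {b} {c} a≢b a≢c b≢c a∈ b∈ c∈ = begin
    3                                              ≤⟨ s≤s (s≤s (s≤s z≤n)) ⟩
    3 ℕ.+ ∣ T - spoke a - spoke b - spoke c ∣      ≤⟨ s≤s (s≤s (x∈p⇒∣p-x∣<∣p∣ c∈″)) ⟩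
    2 ℕ.+ ∣ T - spoke a - spoke b ∣                ≤⟨ s≤s (x∈p⇒∣p-x∣<∣p∣ b∈′) ⟩
    1 ℕ.+ ∣ T - spoke a ∣                          ≤⟨ x∈p⇒∣p-x∣<∣p∣ (spoke-∈-incident a a∈) ⟩
    ∣ T ∣                                          ∎
    where
    open ℕ.≤-Reasoning
    T = S ∩ incident zero
    b∈′ = x∈p∧x≢y⇒x∈p-y (spoke-∈-incident b b∈) (a≢b ∘ sym ∘ spoke-injective)
    c∈′ = x∈p∧x≢y⇒x∈p-y (spoke-∈-incident c c∈) (a≢c ∘ sym ∘ spoke-injective)
    c∈″ = x∈p∧x≢y⇒x∈p-y c∈′ (b≢c ∘ sym ∘ spoke-injective)

  -- Without links `j` and `k` the terminals split into three intervals. Each contains a request,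
  -- namely 0, `j + 1` and `k + 1`, and so needs its own spoke at the root.
  missingLinks⇒3≤degree : ∀ {S} k →
    All (Connected S zero) (requests (2 ℕ.+ toℕ k) (s≤s (Fin.toℕ<n k))) →
    link k ∉ S → ∀ j → toℕ j ℕ.< toℕ k → link j ∉ S → 3 ℕ.≤ degree S zero
  missingLinks⇒3≤degree {S} k conn k∉S j j<k j∉S = distinct-spokes
    (isolated⇒spoke {S} {lo = 0} {hi = toℕ j}
      (λ i i∈S → (λ ()) , avoid j∉S i∈S)
      (served zero (s≤s z≤n)) (z≤n , z≤n))
    (isolated⇒spoke {S} {lo = suc (toℕ j)} {hi = toℕ k}
      (λ i i∈S → avoid j∉S i∈S ∘ ℕ.suc-injective , avoid k∉S i∈S)
      (served (suc j) (s≤s (ℕ.m<n⇒m<1+n j<k))) (ℕ.≤-refl , j<k))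
    -- The last interval runs to the final terminal `p`, which has no link to its right.
    (isolated⇒spoke {S} {lo = suc (toℕ k)} {hi = p}
      (λ i i∈S → avoid k∉S i∈S ∘ ℕ.suc-injective , ℕ.<⇒≢ (Fin.toℕ<n i))
      (served (suc k) ℕ.≤-refl) (ℕ.≤-refl , Fin.toℕ<n k))
    where
    served : ∀ l → toℕ l ℕ.< 2 ℕ.+ toℕ k → Connected S zero (suc l)
    served = requests⁻ {P = Connected S zero} (2 ℕ.+ toℕ k) (s≤s (Fin.toℕ<n k)) conn

    avoid : ∀ {i k} → link k ∉ S → link i ∈ S → toℕ i ≢ toℕ k
    avoid k∉S i∈S eq = k∉S (subst (λ i → link i ∈ S) (Fin.toℕ-injective eq) i∈S)

    distinct-spokes : SpokeWithin S 0 (toℕ j) → SpokeWithin S (suc (toℕ j)) (toℕ k) →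
                      SpokeWithin S (suc (toℕ k)) p → 3 ℕ.≤ degree S zero
    distinct-spokes (a , a∈ , _ , a≤j) (b , b∈ , j<b , b≤k) (c , c∈ , k<c , _) =
      threeSpokes⇒3≤degree {S} {a} {b} {c}
        (Fin.<⇒≢ a<b) (Fin.<⇒≢ (ℕ.<-trans a<b b<c)) (Fin.<⇒≢ b<c) a∈ b∈ c∈
      where
      a<b = ℕ.≤-<-trans a≤j j<b
      b<c = ℕ.≤-<-trans b≤k k<c

  -- OPT after the request of terminal k + 1: the path through terminals 0 , … , k
  -- starting at the root, and the spoke of terminal k + 1.
  module Optimum (k : Fin p) where

    InTree : Fin (suc p) ⊎ Fin p → Set
    InTree (inj₁ j) = j ≡ zero ⊎ j ≡ suc k
    InTree (inj₂ j) = toℕ j ℕ.< toℕ k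

    inTree? : Decidable InTree
    inTree? (inj₁ j) = j Fin.≟ zero ⊎-dec j Fin.≟ suc k
    inTree? (inj₂ j) = toℕ j ℕ.<? toℕ k

    tree : EdgeSet
    tree = select (inTree? ∘ splitAt (suc p))

    spoke∈tree⁻ : ∀ {j} → spoke j ∈ tree → j ≡ zero ⊎ j ≡ suc k
    spoke∈tree⁻ {j} j∈ =
      subst InTree (Fin.splitAt-↑ˡ (suc p) j p) (∈-select⁻ (inTree? ∘ splitAt (suc p)) j∈)

    link∈tree⁻ : ∀ {j} → link j ∈ tree → toℕ j ℕ.< toℕ k
    link∈tree⁻ {j} j∈ =
      subst InTree (Fin.splitAt-↑ʳ (suc p) p j) (∈-select⁻ (inTree? ∘ splitAt (suc p)) j∈)

    spoke∈tree⁺ : ∀ {j} → j ≡ zero ⊎ j ≡ suc k → spoke j ∈ tree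
    spoke∈tree⁺ {j} j∈ =
      ∈-select⁺ (inTree? ∘ splitAt (suc p)) (subst InTree (sym (Fin.splitAt-↑ˡ (suc p) j p)) j∈)

    link∈tree⁺ : ∀ {j} → toℕ j ℕ.< toℕ k → link j ∈ tree
    link∈tree⁺ {j} j∈ =
      ∈-select⁺ (inTree? ∘ splitAt (suc p)) (subst InTree (sym (Fin.splitAt-↑ʳ (suc p) p j)) j∈)

    -- The tree is the path  k + 1 , root , 0 , 1 , … , k ; a vertex is ranked by its position.
    rank : V → ℕ
    rank zero = 1
    rank (suc j) with j Fin.≟ suc k
    ... | yes _ = 0
    ... | no  _ = 2 ℕ.+ toℕ j

    rank-last : rank (suc (suc k)) ≡ 0
    rank-last with suc k Fin.≟ suc k
    ... | yes _  = refl
    ... | no k≢k = contradiction refl k≢k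

    rank-other : ∀ {j} → j ≢ suc k → rank (suc j) ≡ 2 ℕ.+ toℕ j
    rank-other {j} j≢ with j Fin.≟ suc k
    ... | yes j≡ = contradiction j≡ j≢
    ... | no _   = refl

    -- Terminals after `k + 1` lie off the tree but still receive rank `2 + j`, so ranks are
    -- distinct on all of `V`.
    rank-injective : Injective _≡_ _≡_ rank
    rank-injective {zero} {zero} _ = refl
    rank-injective {zero} {suc j} eq with j Fin.≟ suc k
    rank-injective {zero} {suc j} () | yes _
    rank-injective {zero} {suc j} () | no _
    rank-injective {suc i} {zero} eq with i Fin.≟ suc k
    rank-injective {suc i} {zero} () | yes _
    rank-injective {suc i} {zero} () | no _
    rank-injective {suc i} {suc j} eq with i Fin.≟ suc k | j Fin.≟ suc k
    ... | yes refl | yes refl = refl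
    ... | no _     | no _     = cong suc (Fin.toℕ-injective (ℕ.suc-injective (ℕ.suc-injective eq)))

    Consecutive : V × V → Set
    Consecutive (u , v) = rank v ≡ suc (rank u) ⊎ rank u ≡ suc (rank v)

    rank-consecutive : ∀ e → e ∈ tree → Consecutive (ends e)
    rank-consecutive = edge-elim (λ e → e ∈ tree → Consecutive (ends e))
      (λ j j∈ → subst Consecutive (sym (ends-spoke j)) (along-spoke (spoke∈tree⁻ j∈)))
      (λ j j∈ → subst Consecutive (sym (ends-link j)) (along-link (link∈tree⁻ j∈)))
      where
      along-spoke : ∀ {j} → j ≡ zero ⊎ j ≡ suc k → Consecutive (zero , suc j)
      along-spoke (inj₁ refl) = inj₁ (rank-other λ ())
      -- The only tree edge whose ends are listed in descending rank.
      along-spoke (inj₂ refl) = inj₂ (cong suc (sym rank-last))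

      along-link : ∀ {j} → toℕ j ℕ.< toℕ k → Consecutive (suc (inject₁ j) , suc (suc j))
      along-link {j} j<k = inj₁ (begin
        rank (suc (suc j))            ≡⟨ rank-other (Fin.<⇒≢ (s≤s j<k)) ⟩
        3 ℕ.+ toℕ j                   ≡⟨ cong (3 ℕ.+_) (Fin.toℕ-inject₁ j) ⟨
        3 ℕ.+ toℕ (inject₁ j)         ≡⟨ cong suc (rank-other (Fin.<⇒≢ j<1+k)) ⟨
        suc (rank (suc (inject₁ j)))  ∎)
        where
        open ≡-Reasoning
        j<1+k : toℕ (inject₁ j) ℕ.< suc (toℕ k)
        j<1+k = subst (ℕ._< suc (toℕ k)) (sym (Fin.toℕ-inject₁ j)) (ℕ.m<n⇒m<1+n j<k)

    open LinearForest fan rank rank-injective rank-consecutive public using (acyclic; degree≤2)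

    inject₁-fromℕ< : ∀ {r} (r<p : r ℕ.< p) → inject₁ (fromℕ< r<p) ≡ fromℕ< (ℕ.m<n⇒m<1+n r<p)
    inject₁-fromℕ< r<p = Fin.toℕ-injective (trans (Fin.toℕ-inject₁ _)
      (trans (Fin.toℕ-fromℕ< r<p) (sym (Fin.toℕ-fromℕ< (ℕ.m<n⇒m<1+n r<p)))))

    connected-path : ∀ j → toℕ j ℕ.≤ toℕ k → Connected tree zero (suc j)
    connected-path j j≤k = subst (Connected tree zero ∘ suc) (Fin.fromℕ<-toℕ j (Fin.toℕ<n j))
      (along (toℕ j) (Fin.toℕ<n j) j≤k)
      where
      along : ∀ r (r<m : r ℕ.< suc p) → r ℕ.≤ toℕ k → Connected tree zero (suc (fromℕ< r<m))
      along zero    _         _   = (spoke zero , spoke∈tree⁺ (inj₁ refl) , inj₁ (ends-spoke zero)) ◅ ε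
      along (suc r) (s≤s r<p) r<k = along r (ℕ.m<n⇒m<1+n r<p) (ℕ.<⇒≤ r<k) ◅◅
        (link (fromℕ< r<p) , link∈tree⁺ (subst (ℕ._< toℕ k) (sym (Fin.toℕ-fromℕ< r<p)) r<k)
        , inj₁ (trans (ends-link _) (cong (λ l → suc l , suc (suc (fromℕ< r<p))) (inject₁-fromℕ< r<p)))) ◅ ε

    connected-request : ∀ j → toℕ j ℕ.< 2 ℕ.+ toℕ k → Connected tree zero (suc j)
    connected-request j j<2+k with j Fin.≟ suc k
    ... | yes refl = (spoke (suc k) , spoke∈tree⁺ (inj₂ refl) , inj₁ (ends-spoke _)) ◅ ε
    ... | no j≢    = connected-path j
      (ℕ.s≤s⁻¹ (ℕ.≤∧≢⇒< (ℕ.s≤s⁻¹ j<2+k) (j≢ ∘ Fin.toℕ-injective)))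

    isSteinerTree : IsSteinerTree zero (requests (2 ℕ.+ toℕ k) (s≤s (Fin.toℕ<n k))) tree
    isSteinerTree = record
      { connects = requests⁺ {P = Connected tree zero} (2 ℕ.+ toℕ k) (s≤s (Fin.toℕ<n k)) connected-request
      ; spans    = edge-elim _
          (λ j _ → subst (Connected tree zero) (sym (cong proj₁ (ends-spoke j))) ε)
          (λ j j∈ → subst (Connected tree zero) (sym (cong proj₁ (ends-link j)))
            (connected-path (inject₁ j)
              (ℕ.≤-trans (ℕ.≤-reflexive (Fin.toℕ-inject₁ j)) (ℕ.<⇒≤ (link∈tree⁻ j∈)))))
      ; acyclic  = acyclic
      }

  -- Counting the bought spokes

  spokesBefore? : ∀ r → Decidable λ e → ∃[ j ] e ≡ spoke j × toℕ j ℕ.< r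
  spokesBefore? r e = Fin.any? λ j → e Fin.≟ spoke j ×-dec toℕ j ℕ.<? r

  spokesBefore : ℕ → EdgeSet
  spokesBefore r = select (spokesBefore? r)

  -- The cutoff `r` lets the count grow by one spoke per request, which makes an induction over the
  -- requests possible.
  spokeCount : ℕ → EdgeSet → ℕ
  spokeCount r S = ∣ S ∩ spokesBefore r ∣

  ∩-spokesBefore-⊆ : ∀ S r → S ∩ spokesBefore r ⊆ S ∩ spokesBefore (suc r)
  ∩-spokesBefore-⊆ S r e∈ with x∈p∩q⁻ S _ e∈
  ... | e∈S , e∈r with j , eq , j<r ← ∈-select⁻ (spokesBefore? r) e∈r =
    x∈p∩q⁺ (e∈S , ∈-select⁺ (spokesBefore? (suc r)) (j , eq , ℕ.m<n⇒m<1+n j<r))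

  spokeCount-≤ : ∀ r S → spokeCount r S ℕ.≤ spokeCount (suc r) S
  spokeCount-≤ r S = p⊆q⇒∣p∣≤∣q∣ (∩-spokesBefore-⊆ S r)

  spokeCount-< : ∀ {S} j → spoke j ∈ S → spokeCount (toℕ j) S ℕ.< spokeCount (suc (toℕ j)) S
  spokeCount-< {S} j j∈S = p⊂q⇒∣p∣<∣q∣
    ( ∩-spokesBefore-⊆ S (toℕ j)
    , spoke j
    , x∈p∩q⁺ (j∈S , ∈-select⁺ (spokesBefore? (suc (toℕ j))) (j , refl , ℕ.≤-refl))
    , λ j∈ → absurd (∈-select⁻ (spokesBefore? (toℕ j)) (proj₂ (x∈p∩q⁻ S _ j∈))))
    where
    absurd : ¬ (∃[ i ] spoke j ≡ spoke i × toℕ i ℕ.< toℕ j)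
    absurd (i , eq , i<j) = ℕ.<⇒≢ i<j (sym (cong toℕ (spoke-injective eq)))

  spokeCount≤degree : ∀ r S → spokeCount r S ℕ.≤ degree S zero
  spokeCount≤degree r S = p⊆q⇒∣p∣≤∣q∣ at-root
    where
    at-root : S ∩ spokesBefore r ⊆ S ∩ incident zero
    at-root e∈ with x∈p∩q⁻ S _ e∈
    ... | e∈S , e∈r with j , refl , _ ← ∈-select⁻ (spokesBefore? r) e∈r =
      spoke-∈-incident j e∈S

  connected-⊤ : ∀ j → Connected ⊤ zero (suc j)
  connected-⊤ j = (spoke j , ∈⊤ , inj₁ (ends-spoke j)) ◅ ε

  -- The number of vertices times the number of edges: link `k` then weighs n times as much as one
  -- copy of link `k - 1` for every edge of the graph.
  ratio : ℕ
  ratio = (2 ℕ.+ p) ℕ.* edges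

  cost : Fin edges → ℕ
  cost = [ (λ _ → 0) , (λ j → ratio ℕ.^ toℕ j) ]′ ∘ splitAt (suc p)

  cost-spoke : ∀ j → cost (spoke j) ≡ 0
  cost-spoke j rewrite Fin.splitAt-↑ˡ (suc p) j p = refl

  cost-link : ∀ j → cost (link j) ≡ ratio ℕ.^ toℕ j
  cost-link j rewrite Fin.splitAt-↑ʳ (suc p) p j = refl

-- Linearly ordered fields

module OrderedFieldProperties {k ℓ₁ ℓ₂ : Level} (K : LinearlyOrderedField k ℓ₁ ℓ₂) where
  open LinearlyOrderedField K hiding (zero)
    renaming (refl to ≈-refl; sym to ≈-sym; trans to ≈-trans)

  poset : Poset k ℓ₁ ℓ₂
  poset = record { isPartialOrder = IsTotalOrder.isPartialOrder isTotalOrder }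

  open Poset poset public using (≤-respˡ-≈; ≤-respʳ-≈) renaming
    (refl to ≤-refl; reflexive to ≤-reflexive; trans to ≤-trans; antisym to ≤-antisym)
  open IsTotalOrder isTotalOrder public using () renaming (total to ≤-total)
  open MultProperties semiring using (×-homo-+)
  open RingProperties ring using (-1*x≈-x; -‿involutive)
  open ≤-Reasoning poset

  +-mono-≤ : ∀ {x y u v} → x ≤ y → u ≤ v → x + u ≤ y + v
  +-mono-≤ {x} {y} {u} {v} x≤y u≤v = begin
    x + u ≤⟨ +-monoˡ-≤ u x≤y ⟩
    y + u ≈⟨ +-comm y u ⟩
    u + y ≤⟨ +-monoˡ-≤ y u≤v ⟩
    v + y ≈⟨ +-comm v y ⟩
    y + v ∎

  +-cancelʳ-≤ : ∀ z {x y} → x + z ≤ y + z → x ≤ y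
  +-cancelʳ-≤ z {x} {y} x+z≤y+z = begin
    x             ≈⟨ cancel x ⟨
    x + z + - z   ≤⟨ +-monoˡ-≤ (- z) x+z≤y+z ⟩
    y + z + - z   ≈⟨ cancel y ⟩
    y             ∎
    where
    cancel : ∀ w → w + z + - z ≈ w
    cancel w = ≈-trans (+-assoc w z (- z)) (≈-trans (+-congˡ (-‿inverseʳ z)) (+-identityʳ w))

  x≤y⇒0≤y-x : ∀ {x y} → x ≤ y → 0# ≤ y + - x
  x≤y⇒0≤y-x {x} x≤y = ≤-respˡ-≈ (-‿inverseʳ x) (+-monoˡ-≤ (- x) x≤y)

  *-monoˡ-≤ : ∀ {z x y} → 0# ≤ z → x ≤ y → z * x ≤ z * y
  *-monoˡ-≤ {z} {x} {y} 0≤z x≤y = begin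
    z * x                      ≈⟨ +-identityˡ _ ⟨
    0# + z * x                 ≤⟨ +-monoˡ-≤ (z * x) (*-nonNeg 0≤z (x≤y⇒0≤y-x x≤y)) ⟩
    z * (y + - x) + z * x      ≈⟨ distribˡ z _ _ ⟨
    z * (y + - x + x)
      ≈⟨ *-congˡ (≈-trans (+-assoc y (- x) x) (≈-trans (+-congˡ (-‿inverseˡ x)) (+-identityʳ y))) ⟩
    z * y                      ∎

  0≤1 : 0# ≤ 1#
  0≤1 with ≤-total 0# 1#
  ... | inj₁ 0≤1 = 0≤1
  -- From 0 ≤ -1 follows 0 ≤ (-1)(-1) = 1.
  ... | inj₂ 1≤0 = ≤-respʳ-≈ (≈-trans (-1*x≈-x (- 1#)) (-‿involutive 1#)) (*-nonNeg 0≤-1 0≤-1)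
    where
    0≤-1 : 0# ≤ - 1#
    0≤-1 = ≤-respʳ-≈ (+-identityˡ (- 1#)) (x≤y⇒0≤y-x 1≤0)

  0≤fromℕ : ∀ n → 0# ≤ fromℕ n
  0≤fromℕ zero    = ≤-refl
  0≤fromℕ (suc n) = ≤-respˡ-≈ (+-identityˡ 0#) (+-mono-≤ 0≤1 (0≤fromℕ n))

  fromℕ-mono-≤ : ∀ {m n} → m ℕ.≤ n → fromℕ m ≤ fromℕ n
  fromℕ-mono-≤ {n = n} z≤n = 0≤fromℕ n
  fromℕ-mono-≤ (s≤s m≤n)   = +-mono-≤ ≤-refl (fromℕ-mono-≤ m≤n)

  sum-mono-≤ : ∀ {n} {f g : Vector Carrier n} → (∀ i → f i ≤ g i) → sum f ≤ sum g
  sum-mono-≤ {zero}  f≤g = ≤-refl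
  sum-mono-≤ {suc n} f≤g = +-mono-≤ (f≤g zero) (sum-mono-≤ (f≤g ∘ suc))

  sum-nonNeg : ∀ {n} {f : Vector Carrier n} → (∀ i → 0# ≤ f i) → 0# ≤ sum f
  sum-nonNeg {zero}  0≤f = ≤-refl
  sum-nonNeg {suc n} 0≤f = ≤-respˡ-≈ (+-identityˡ 0#) (+-mono-≤ (0≤f zero) (sum-nonNeg (0≤f ∘ suc)))

  term≤sum : ∀ {n} {f : Vector Carrier n} → (∀ i → 0# ≤ f i) → ∀ i → f i ≤ sum f
  term≤sum 0≤f zero    = ≤-respˡ-≈ (+-identityʳ _) (+-mono-≤ ≤-refl (sum-nonNeg (0≤f ∘ suc)))
  term≤sum 0≤f (suc i) = ≤-respˡ-≈ (+-identityˡ _) (+-mono-≤ (0≤f zero) (term≤sum (0≤f ∘ suc) i))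

  sum≤fromℕ : ∀ {n} {f : Vector Carrier n} b → (∀ i → f i ≤ fromℕ b) → sum f ≤ fromℕ (n ℕ.* b)
  sum≤fromℕ {zero}  b f≤b = ≤-refl
  sum≤fromℕ {suc n} b f≤b =
    ≤-respʳ-≈ (≈-sym (×-homo-+ 1# b (n ℕ.* b))) (+-mono-≤ (f≤b zero) (sum≤fromℕ b (f≤b ∘ suc)))

  0<x*y≈1 : ∀ {x y} → 0# ≤ y → x * y ≈ 1# → 0# < x
  0<x*y≈1 {x} {y} 0≤y xy≈1 = 0≤x , λ 0≈x → 0≉1 (≈-trans (≈-sym (zeroˡ y)) (≈-trans (*-congʳ 0≈x) xy≈1))
    where
    0≤x : 0# ≤ x
    0≤x with ≤-total 0# x
    ... | inj₁ 0≤x = 0≤x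
    ... | inj₂ x≤0 = contradiction (≤-antisym 0≤1 (begin
      1#     ≈⟨ xy≈1 ⟨
      x * y  ≈⟨ *-comm x y ⟩
      y * x  ≤⟨ *-monoˡ-≤ 0≤y x≤0 ⟩
      y * 0# ≈⟨ zeroʳ y ⟩
      0#     ∎)) 0≉1

  -- An ordered field has characteristic zero, since 1 ≤ `fromℕ (suc n)`.
  fromℕ≉0 : ∀ n → ¬ (fromℕ (suc n) ≈ 0#)
  fromℕ≉0 n eq = 0≉1 (≤-antisym 0≤1 (begin
    1#            ≈⟨ +-identityʳ 1# ⟨
    fromℕ 1       ≤⟨ fromℕ-mono-≤ {1} {suc n} (s≤s z≤n) ⟩
    fromℕ (suc n) ≈⟨ eq ⟩
    0#            ∎))

-- Expectations over distributions and over runs of an algorithm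

module ExpectationProperties {k ℓ₁ ℓ₂ : Level} (K : LinearlyOrderedField k ℓ₁ ℓ₂) where
  open LinearlyOrderedField K hiding (zero)
    renaming (refl to ≈-refl; sym to ≈-sym; trans to ≈-trans)
  open OrderedFieldProperties K
  open SumProperties semiring using (∑-distrib-+; *-distribˡ-sum; *-distribʳ-sum; sum-cong-≋)
  open Online K

  module _ {a : Level} {A : Set a} (D : Distribution A) where
    open Distribution D

    expectation-mono : ∀ f g → (∀ i → f (outcome i) ≤ g (outcome i)) →
                       expectation f ≤ expectation g
    expectation-mono f g f≤g = sum-mono-≤ λ i → *-monoˡ-≤ (proj₁ (positive i)) (f≤g i)

    expectation-cong : ∀ f g → (∀ x → f x ≈ g x) → expectation f ≈ expectation g
    expectation-cong f g f≈g = sum-cong-≋ {support} λ i → *-congˡ (f≈g (outcome i))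

    expectation-+ : ∀ f g → expectation (λ x → f x + g x) ≈ expectation f + expectation g
    expectation-+ f g = ≈-trans
      (sum-cong-≋ {support} λ i → distribˡ (prob i) (f (outcome i)) (g (outcome i)))
      (∑-distrib-+ (λ i → prob i * f (outcome i)) (λ i → prob i * g (outcome i)))

    expectation-* : ∀ z f → expectation (λ x → z * f x) ≈ z * expectation f
    expectation-* z f = ≈-trans
      (sum-cong-≋ {support} λ i → x∙yz≈y∙xz (prob i) z (f (outcome i)))
      (≈-sym (*-distribˡ-sum z (λ i → prob i * f (outcome i))))
      where open CommutativeSemigroupProperties *-commutativeSemigroup using (x∙yz≈y∙xz)

    expectation-const : ∀ z → expectation (λ _ → z) ≈ z
    expectation-const z =
      ≈-trans (≈-sym (*-distribʳ-sum z prob)) (≈-trans (*-congʳ total) (*-identityˡ z))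

  module _ (A : OnlineAlgorithm) {n : ℕ} (I : Online.Instance K n) where
    open Online.Instance I
    open OnlineAlgorithm A

    after : History → Fin n → List (Fin n) → (EdgeSet → Carrier) → EdgeSet → Carrier
    after h t ts f S = expectedFrom A I ((t , S) ∷ h) ts f

    expected-mono : ∀ h ts {f g} → (∀ S → f S ≤ g S) →
                    expectedFrom A I h ts f ≤ expectedFrom A I h ts g
    expected-mono h []       f≤g = f≤g (bought h)
    expected-mono h (t ∷ ts) {f} {g} f≤g =
      expectation-mono (choose I h t) (after h t ts f) (after h t ts g)
        λ i → expected-mono (_ ∷ h) ts f≤g

    -- Every final edge set connects the last request `t` to the root by `serves`, so the comparison
    -- is demanded only of such sets.
    expected-mono-served : ∀ h ts t {f g} → Connected ⊤ root t →
      (∀ S → Connected S root t → f S ≤ g S) →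
      expectedFrom A I h (ts ++ [ t ]) f ≤ expectedFrom A I h (ts ++ [ t ]) g
    expected-mono-served h [] t {f} {g} c f≤g =
      expectation-mono (choose I h t) (after h t [] f) (after h t [] g)
        λ i → f≤g _ (serves I h t c i)
    expected-mono-served h (t′ ∷ ts) t {f} {g} c f≤g =
      expectation-mono (choose I h t′) (after h t′ (ts ++ [ t ]) f) (after h t′ (ts ++ [ t ]) g)
        λ i → expected-mono-served (_ ∷ h) ts t c f≤g

    expected-+ : ∀ h ts f g → expectedFrom A I h ts (λ S → f S + g S) ≈
                              expectedFrom A I h ts f + expectedFrom A I h ts g
    expected-+ h []       f g = ≈-refl
    expected-+ h (t ∷ ts) f g = ≈-trans
      (expectation-cong (choose I h t) (after h t ts (λ S → f S + g S))
        (λ S → after h t ts f S + after h t ts g S) λ S → expected-+ ((t , S) ∷ h) ts f g)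
      (expectation-+ (choose I h t) (after h t ts f) (after h t ts g))

    expected-* : ∀ h ts z f → expectedFrom A I h ts (λ S → z * f S) ≈
                              z * expectedFrom A I h ts f
    expected-* h []       z f = ≈-refl
    expected-* h (t ∷ ts) z f = ≈-trans
      (expectation-cong (choose I h t) (after h t ts (λ S → z * f S))
        (λ S → z * after h t ts f S) λ S → expected-* ((t , S) ∷ h) ts z f)
      (expectation-* (choose I h t) z (after h t ts f))

    expected-const : ∀ h ts z → expectedFrom A I h ts (λ _ → z) ≈ z
    expected-const h []       z = ≈-refl
    expected-const h (t ∷ ts) z = ≈-trans
      (expectation-cong (choose I h t) (after h t ts (λ _ → z)) (λ _ → z)
        λ S → expected-const ((t , S) ∷ h) ts z)
      (expectation-const (choose I h t) z)

    expected-nonNeg : ∀ h ts {f} → (∀ S → 0# ≤ f S) → 0# ≤ expectedFrom A I h ts f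
    expected-nonNeg h ts 0≤f = ≤-respˡ-≈ (expected-const h ts 0#) (expected-mono h ts 0≤f)

    -- A further request only enlarges the bought set in each run, because edges are never removed.
    expected-snoc : ∀ h ts t {f} → (∀ S T → f T ≤ f (S ∪ T)) →
                    expectedFrom A I h ts f ≤ expectedFrom A I h (ts ++ [ t ]) f
    expected-snoc h [] t {f} f-mono = ≤-respˡ-≈ (expectation-const (choose I h t) (f (bought h)))
      (expectation-mono (choose I h t) (λ _ → f (bought h)) (after h t [] f)
        λ i → f-mono _ (bought h))
    expected-snoc h (t′ ∷ ts) t {f} f-mono =
      expectation-mono (choose I h t′) (after h t′ ts f) (after h t′ (ts ++ [ t ]) f)
        λ i → expected-snoc (_ ∷ h) ts t f-mono

-- Weights of edge sets

module WeightProperties {k ℓ₁ ℓ₂ : Level} (K : LinearlyOrderedField k ℓ₁ ℓ₂)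
  {n : ℕ} (I : Online.Instance K n) where
  open LinearlyOrderedField K hiding (zero)
    renaming (refl to ≈-refl; sym to ≈-sym; trans to ≈-trans)
  open OrderedFieldProperties K
  open Online.Instance I

  share : EdgeSet → Fin size → Carrier
  share S e = if lookup S e then edgeWeight e else 0#

  share-∈ : ∀ {S e} → e ∈ S → share S e ≡ edgeWeight e
  share-∈ e∈S rewrite []=⇒lookup e∈S = refl

  share-nonNeg : ∀ S e → 0# ≤ share S e
  share-nonNeg S e with lookup S e
  ... | true  = nonNeg e
  ... | false = ≤-refl

  share≤ : ∀ S e {z} → 0# ≤ z → (e ∈ S → edgeWeight e ≤ z) → share S e ≤ z
  share≤ S e 0≤z w≤z with lookup S e in eq
  ... | true  = w≤z (lookup⇒[]= e S eq)
  ... | false = 0≤z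

  edgeWeight≤weight : ∀ {S e} → e ∈ S → edgeWeight e ≤ weight S
  edgeWeight≤weight {S} {e} e∈S =
    subst (_≤ weight S) (share-∈ e∈S) (term≤sum (share-nonNeg S) e)

  -- Weightless edges are exempt from the inclusion, because solutions are compared regardless of
  -- which spokes they use.
  weight-mono : ∀ S T → (∀ e → e ∈ S → e ∈ T ⊎ edgeWeight e ≤ 0#) → weight S ≤ weight T
  weight-mono S T S⊆T = sum-mono-≤ λ e → share≤ S e (share-nonNeg T e) λ e∈S →
    [ (λ e∈T → ≤-reflexive (reflexive (sym (share-∈ e∈T))))
    , (λ w≤0 → ≤-trans w≤0 (share-nonNeg T e)) ]′ (S⊆T e e∈S)

  weight≤fromℕ : ∀ S b → (∀ e → e ∈ S → edgeWeight e ≤ fromℕ b) → weight S ≤ fromℕ (size ℕ.* b)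
  weight≤fromℕ S b w≤b = sum≤fromℕ b λ e → share≤ S e (0≤fromℕ b) (w≤b e)

-- The constant 1/8

module OneEighth {k ℓ₁ ℓ₂ : Level} (K : LinearlyOrderedField k ℓ₁ ℓ₂) where
  open LinearlyOrderedField K hiding (zero)
    renaming (refl to ≈-refl; sym to ≈-sym; trans to ≈-trans)
  open OrderedFieldProperties K
  open MultProperties semiring using (×1-homo-*)
  open ≤-Reasoning poset

  ⅛ : Carrier
  ⅛ = proj₁ (inverse (fromℕ 8) (fromℕ≉0 7))

  ⅛*8≈1 : ⅛ * fromℕ 8 ≈ 1#
  ⅛*8≈1 = ≈-trans (*-comm ⅛ (fromℕ 8)) (proj₂ (inverse (fromℕ 8) (fromℕ≉0 7)))

  0<⅛ : 0# < ⅛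
  0<⅛ = 0<x*y≈1 (0≤fromℕ 8) ⅛*8≈1

  double : ∀ E → E + E ≈ fromℕ 2 * E
  double E = ≈-sym (≈-trans (distribʳ E 1# _)
    (+-cong (*-identityˡ E) (≈-trans (*-congʳ (+-identityʳ 1#)) (*-identityˡ E))))

  -- From E ≥ a / 2 and x ≤ 4 a follows x / 8 ≤ a / 2 ≤ E. Both outcomes of the adversary are
  -- concluded in this way.
  scale : ∀ {x E} a → fromℕ a ≤ E + E → x ≤ fromℕ (4 ℕ.* a) → ⅛ * x ≤ E
  scale {x} {E} a a≤2E x≤4a = begin
    ⅛ * x                          ≤⟨ *-monoˡ-≤ (proj₁ 0<⅛) x≤4a ⟩
    ⅛ * fromℕ (4 ℕ.* a)            ≈⟨ *-congˡ (×1-homo-* 4 a) ⟩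
    ⅛ * (fromℕ 4 * fromℕ a)        ≤⟨ *-monoˡ-≤ (proj₁ 0<⅛) (*-monoˡ-≤ (0≤fromℕ 4) a≤2E) ⟩
    ⅛ * (fromℕ 4 * (E + E))        ≈⟨ *-congˡ (*-congˡ (double E)) ⟩
    ⅛ * (fromℕ 4 * (fromℕ 2 * E))  ≈⟨ *-congˡ (*-assoc (fromℕ 4) (fromℕ 2) E) ⟨
    ⅛ * (fromℕ 4 * fromℕ 2 * E)    ≈⟨ *-congˡ (*-congʳ (×1-homo-* 4 2)) ⟨
    ⅛ * (fromℕ 8 * E)              ≈⟨ *-assoc ⅛ (fromℕ 8) E ⟨
    ⅛ * fromℕ 8 * E                ≈⟨ *-congʳ ⅛*8≈1 ⟩
    1# * E                         ≈⟨ *-identityˡ E ⟩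
    E                              ∎

-- The weighted fan as an instance, and its optima

module LowerBound {κ ℓ₁ ℓ₂ : Level} (K : LinearlyOrderedField κ ℓ₁ ℓ₂) (p : ℕ) where
  open LinearlyOrderedField K hiding (zero)
    renaming (refl to ≈-refl; sym to ≈-sym; trans to ≈-trans)
  open OrderedFieldProperties K
  open ExpectationProperties K
  open OneEighth K
  open MultProperties semiring using (×1-homo-*)
  open CommutativeSemigroupProperties +-commutativeSemigroup using (interchange)
  open Online K
  open Fan p
  open ≤-Reasoning poset

  I : Online.Instance K (2 ℕ.+ p)
  I = record
    { graph      = fan
    ; edgeWeight = fromℕ ∘ cost
    ; nonNeg     = 0≤fromℕ ∘ cost
    ; root       = zero
    ; bound      = 2
    }

  open Online.Instance I using (EdgeSet; Connected; maxDegree; weight; edgeWeight; graph; IsOPT; IsFeasible)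
  open WeightProperties K I

  sequence : Fin p → List V
  sequence k = requests (2 ℕ.+ toℕ k) (s≤s (Fin.toℕ<n k))

  -- Exhibits terminal `k + 1` as the last request, in the form that `expected-mono-served` expects.
  sequence-snoc : ∀ k → sequence k ≡
    requests (suc (toℕ k)) (ℕ.<⇒≤ (s≤s (Fin.toℕ<n k))) ++ [ suc (suc k) ]
  sequence-snoc k = cong (λ j → requests (suc (toℕ k)) (ℕ.<⇒≤ (s≤s (Fin.toℕ<n k))) ++ [ suc (suc j) ])
    (Fin.fromℕ<-toℕ k (Fin.toℕ<n k))

  heavy : Fin p → ℕ
  heavy k = ratio ℕ.^ toℕ k

  heavy≤weight : ∀ {S k j} → link j ∈ S → toℕ k ℕ.≤ toℕ j → fromℕ (heavy k) ≤ weight S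
  heavy≤weight {S} {k} {j} j∈S k≤j = begin
    fromℕ (heavy k)       ≤⟨ fromℕ-mono-≤ {heavy k} {heavy j} (ℕ.^-monoʳ-≤ ratio k≤j) ⟩
    fromℕ (heavy j)       ≡⟨ cong fromℕ (cost-link j) ⟨
    edgeWeight (link j)   ≤⟨ edgeWeight≤weight {S} {link j} j∈S ⟩
    weight S              ∎

  -- For `k` = 0 the tree consists of two spokes and weighs 0. The assumption `1 ≤ k` makes the
  -- optimum positive.
  module Opt (k : Fin p) (1≤k : 1 ℕ.≤ toℕ k) where
    open Optimum k

    opt : Carrier
    opt = weight tree

    -- The weight of link `k - 1`, the heaviest edge of the tree.
    unit : ℕ
    unit = ratio ℕ.^ ℕ.pred (toℕ k)

    heavy≡ : heavy k ≡ (2 ℕ.+ p) ℕ.* (edges ℕ.* unit)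
    heavy≡ = trans (cong (ratio ℕ.^_) (sym (ℕ.suc-pred (toℕ k) {{ℕ.>-nonZero 1≤k}})))
      (ℕ.*-assoc (2 ℕ.+ p) edges unit)

    cost≤unit : ∀ e → e ∈ tree → cost e ℕ.≤ unit
    cost≤unit = edge-elim (λ e → e ∈ tree → cost e ℕ.≤ unit)
      (λ j _ → ℕ.≤-trans (ℕ.≤-reflexive (cost-spoke j)) z≤n)
      (λ j j∈ → ℕ.≤-trans (ℕ.≤-reflexive (cost-link j))
        (ℕ.^-monoʳ-≤ ratio (ℕ.<⇒≤pred (link∈tree⁻ j∈))))

    opt≤unit : opt ≤ fromℕ (edges ℕ.* unit)
    opt≤unit = weight≤fromℕ tree unit λ e e∈ → fromℕ-mono-≤ {cost e} {unit} (cost≤unit e e∈)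

    n*opt≤heavy : fromℕ (2 ℕ.+ p) * opt ≤ fromℕ (heavy k)
    n*opt≤heavy = begin
      fromℕ (2 ℕ.+ p) * opt                     ≤⟨ *-monoˡ-≤ (0≤fromℕ (2 ℕ.+ p)) opt≤unit ⟩
      fromℕ (2 ℕ.+ p) * fromℕ (edges ℕ.* unit)  ≈⟨ ×1-homo-* (2 ℕ.+ p) (edges ℕ.* unit) ⟨
      fromℕ ((2 ℕ.+ p) ℕ.* (edges ℕ.* unit))    ≡⟨ cong fromℕ heavy≡ ⟨
      fromℕ (heavy k)                           ∎

    opt≤heavy : opt ≤ fromℕ (heavy k)
    opt≤heavy = ≤-trans opt≤unit (fromℕ-mono-≤ {edges ℕ.* unit} {heavy k} (ℕ.≤-trans
      (ℕ.m≤n*m (edges ℕ.* unit) (2 ℕ.+ p)) (ℕ.≤-reflexive (sym heavy≡))))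

    -- Link `k` alone already weighs at least `opt`. Without it, the degree bound at the root forces
    -- every link before `k`, and the remaining edges of the tree are free spokes.
    opt≤weight : ∀ S → IsFeasible (sequence k) S → opt ≤ weight S
    opt≤weight S feasible with link k ∈? S
    ... | yes k∈S = ≤-trans opt≤heavy (heavy≤weight {S} {k} {k} k∈S ℕ.≤-refl)
    ... | no  k∉S = weight-mono tree S (edge-elim (λ e → e ∈ tree → e ∈ S ⊎ edgeWeight e ≤ 0#)
      (λ j _ → inj₂ (≤-reflexive (reflexive (cong fromℕ (cost-spoke j)))))
      (λ j j∈ → inj₁ (present j (link∈tree⁻ j∈))))
      where
      open Online.Instance.IsFeasible feasible renaming (isSteinerTree to steinerTree)
      present : ∀ j → toℕ j ℕ.< toℕ k → link j ∈ S
      present j j<k with link j ∈? S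
      ... | yes j∈S = j∈S
      ... | no  j∉S = contradiction
        (missingLinks⇒3≤degree {S} k (Graph.IsSteinerTree.connects steinerTree) k∉S j j<k j∉S)
        (ℕ.<⇒≱ (s≤s (ℕ.≤-trans (degree≤maxDegree graph S zero) degreeBounded)))

    isOPT : IsOPT (sequence k) opt
    isOPT = record
      { attained = tree , record
          { isSteinerTree = isSteinerTree
          ; degreeBounded = maxDegree≤ graph {tree} degree≤2
          } , ≈-refl
      ; minimum  = opt≤weight
      }

    -- The tree contains link 0, of weight Q ^ 0 = 1.
    1≤opt : 1# ≤ opt
    1≤opt = begin
      1#                       ≈⟨ +-identityʳ 1# ⟨
      fromℕ 1                  ≡⟨ cong (fromℕ ∘ (ratio ℕ.^_)) (Fin.toℕ-fromℕ< 0<p) ⟨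
      fromℕ (heavy first)      ≤⟨ heavy≤weight {tree} {first} {first} (link∈tree⁺ first<k) ℕ.≤-refl ⟩
      opt                      ∎
      where
      0<p : 0 ℕ.< p
      0<p = ℕ.≤-<-trans z≤n (Fin.toℕ<n k)
      first : Fin p
      first = fromℕ< 0<p
      first<k : toℕ first ℕ.< toℕ k
      first<k = subst (ℕ._< toℕ k) (sym (Fin.toℕ-fromℕ< 0<p)) 1≤k

    0<opt : 0# < opt
    0<opt = ≤-trans 0≤1 1≤opt , λ 0≈opt → 0≉1 (≤-antisym 0≤1 (≤-respʳ-≈ (≈-sym 0≈opt) 1≤opt))

  -- The adversary against a fixed algorithm

  module Play (A : OnlineAlgorithm) where

    indicator : Fin (suc p) → EdgeSet → Carrier
    indicator j S = if lookup S (spoke j) then 1# else 0#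

    -- The chance that the spoke of terminal `k + 1` is bought by the time that request has been
    -- served, possibly earlier.
    spokeProbability : Fin p → Carrier
    spokeProbability k = expectedFrom A I [] (sequence k) (indicator (suc k))

    weight-nonNeg : ∀ S → 0# ≤ weight S
    weight-nonNeg S = sum-nonNeg (share-nonNeg S)

    -- The alternative between spoke and heavy link as one inequality, linear in the weight and the
    -- indicator, so that expectations can be taken.
    heavy-or-spoke : ∀ k S → Connected S zero (suc (suc k)) →
                     fromℕ (heavy k) ≤ weight S + fromℕ (heavy k) * indicator (suc k) S
    heavy-or-spoke k S c with lookup S (spoke (suc k)) in eq
    ... | true  = begin
      fromℕ (heavy k)                   ≈⟨ +-identityˡ _ ⟨
      0# + fromℕ (heavy k)              ≤⟨ +-mono-≤ (weight-nonNeg S) (≤-reflexive (≈-sym (*-identityʳ _))) ⟩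
      weight S + fromℕ (heavy k) * 1#   ∎
    ... | false with j , j∈S , k≤j ← noSpoke⇒heavyLink {S} k c
                       (λ k∈S → contradiction (trans (sym eq) ([]=⇒lookup k∈S)) λ ()) = begin
      fromℕ (heavy k)                   ≤⟨ heavy≤weight {S} {k} {j} j∈S k≤j ⟩
      weight S                          ≈⟨ +-identityʳ _ ⟨
      weight S + 0#                     ≈⟨ +-congˡ (zeroʳ _) ⟨
      weight S + fromℕ (heavy k) * 0#   ∎

    heavy≤expectation : ∀ k → fromℕ (heavy k) ≤
      𝔼[weight] A I (sequence k) + fromℕ (heavy k) * spokeProbability k
    heavy≤expectation k = begin
      w                                                   ≈⟨ expected-const A I [] (sequence k) w ⟨
      expectedFrom A I [] (sequence k) (λ _ → w)          ≤⟨ served ⟩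
      expectedFrom A I [] (sequence k) (λ S → weight S + w * indicator (suc k) S)
        ≈⟨ expected-+ A I [] (sequence k) weight (λ S → w * indicator (suc k) S) ⟩
      𝔼[weight] A I (sequence k) + expectedFrom A I [] (sequence k) (λ S → w * indicator (suc k) S)
        ≈⟨ +-congˡ (expected-* A I [] (sequence k) w (indicator (suc k))) ⟩
      𝔼[weight] A I (sequence k) + w * spokeProbability k ∎
      where
      w = fromℕ (heavy k)
      served : expectedFrom A I [] (sequence k) (λ _ → w) ≤
               expectedFrom A I [] (sequence k) (λ S → weight S + w * indicator (suc k) S)
      served rewrite sequence-snoc k =
        expected-mono-served A I [] (requests (suc (toℕ k)) _) (suc (suc k)) {λ _ → w}
          (connected-⊤ (suc k)) (heavy-or-spoke k)

    -- Doubling w ≤ E + w q gives 2 w ≤ 2 E + 2 q w ≤ 2 E + w. Working with doubles avoids division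
    -- by 2.
    heavy≤2𝔼[weight] : ∀ k → spokeProbability k + spokeProbability k ≤ 1# →
      fromℕ (heavy k) ≤ 𝔼[weight] A I (sequence k) + 𝔼[weight] A I (sequence k)
    heavy≤2𝔼[weight] k 2q≤1 = +-cancelʳ-≤ w (begin
      w + w                         ≤⟨ +-mono-≤ (heavy≤expectation k) (heavy≤expectation k) ⟩
      (E + w * q) + (E + w * q)     ≈⟨ interchange E (w * q) E (w * q) ⟩
      (E + E) + (w * q + w * q)     ≈⟨ +-congˡ (distribˡ w q q) ⟨
      (E + E) + w * (q + q)         ≤⟨ +-mono-≤ ≤-refl (*-monoˡ-≤ (0≤fromℕ (heavy k)) 2q≤1) ⟩
      (E + E) + w * 1#              ≈⟨ +-congˡ (*-identityʳ w) ⟩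
      (E + E) + w                   ∎)
      where
      w = fromℕ (heavy k)
      q = spokeProbability k
      E = 𝔼[weight] A I (sequence k)

    expectedSpokes : ∀ r → .(r ℕ.≤ p) → Carrier
    expectedSpokes r r≤p =
      expectedFrom A I [] (requests (suc r) (s≤s r≤p)) (fromℕ ∘ spokeCount (suc r))

    spokeCount-step : ∀ k S → fromℕ (spokeCount (suc (toℕ k)) S) + indicator (suc k) S ≤
                              fromℕ (spokeCount (2 ℕ.+ toℕ k) S)
    spokeCount-step k S with lookup S (spoke (suc k)) in eq
    ... | true  = ≤-trans (≤-reflexive (+-comm _ 1#))
      (fromℕ-mono-≤ {suc (spokeCount (suc (toℕ k)) S)} (spokeCount-< {S} (suc k) (lookup⇒[]= _ S eq)))
    ... | false = ≤-trans (≤-reflexive (+-identityʳ _)) (fromℕ-mono-≤ (spokeCount-≤ (suc (toℕ k)) S))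

    spokeCount-∪ : ∀ r S T → fromℕ (spokeCount r T) ≤ fromℕ (spokeCount r (S ∪ T))
    spokeCount-∪ r S T = fromℕ-mono-≤ (p⊆q⇒∣p∣≤∣q∣ λ e∈ →
      let e∈T , e∈r = x∈p∩q⁻ T (spokesBefore r) e∈ in x∈p∩q⁺ (q⊆p∪q S T e∈T , e∈r))

    -- Spokes counted before stay bought during the request of terminal `k + 1`, and its own spoke
    -- adds its probability.
    expectedSpokes-step : ∀ k → expectedSpokes (toℕ k) (ℕ.<⇒≤ (Fin.toℕ<n k)) + spokeProbability k ≤
                                expectedSpokes (suc (toℕ k)) (Fin.toℕ<n k)
    expectedSpokes-step k = begin
      D + spokeProbability k
        ≤⟨ +-monoˡ-≤ (spokeProbability k)
             (expected-snoc A I [] (requests (suc (toℕ k)) (s≤s k≤p))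
               (suc (fromℕ< (s≤s (Fin.toℕ<n k)))) {count} (spokeCount-∪ (suc (toℕ k)))) ⟩
      expectedFrom A I [] (sequence k) count + spokeProbability k
        ≈⟨ expected-+ A I [] (sequence k) count (indicator (suc k)) ⟨
      expectedFrom A I [] (sequence k) (λ S → count S + indicator (suc k) S)
        ≤⟨ expected-mono A I [] (sequence k) (spokeCount-step k) ⟩
      expectedSpokes (suc (toℕ k)) (Fin.toℕ<n k) ∎
      where
      k≤p : toℕ k ℕ.≤ p
      k≤p = ℕ.<⇒≤ (Fin.toℕ<n k)
      D = expectedSpokes (toℕ k) k≤p
      count : EdgeSet → Carrier
      count S = fromℕ (spokeCount (suc (toℕ k)) S)

    -- The expected count is at least (r - 1) / 2: each of the terminals 2 , ... , r contributes
    -- 1/2, and terminals 0 and 1 get no credit, since the search starts at `k` = 1.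
    ManySpokes : ∀ r → .(r ℕ.≤ p) → Set ℓ₂
    ManySpokes r r≤p = fromℕ (ℕ.pred r) ≤ expectedSpokes r r≤p + expectedSpokes r r≤p

    Unlikely : Set ℓ₂
    Unlikely = Σ[ k ∈ Fin p ] 1 ℕ.≤ toℕ k × spokeProbability k + spokeProbability k ≤ 1#

    search-step : ∀ k → 1 ℕ.≤ toℕ k → ManySpokes (toℕ k) (ℕ.<⇒≤ (Fin.toℕ<n k)) →
                  Unlikely ⊎ ManySpokes (suc (toℕ k)) (Fin.toℕ<n k)
    search-step k 1≤k many with ≤-total (q + q) 1#
      where q = spokeProbability k
    ... | inj₁ 2q≤1 = inj₁ (k , 1≤k , 2q≤1)
    ... | inj₂ 1≤2q = inj₂ (begin
      fromℕ (toℕ k)                     ≡⟨ cong fromℕ (ℕ.suc-pred (toℕ k) {{ℕ.>-nonZero 1≤k}}) ⟨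
      1# + fromℕ (ℕ.pred (toℕ k))       ≤⟨ +-mono-≤ 1≤2q many ⟩
      (q + q) + (D + D)                 ≈⟨ +-comm _ _ ⟩
      (D + D) + (q + q)                 ≈⟨ interchange D D q q ⟩
      (D + q) + (D + q)                 ≤⟨ +-mono-≤ (expectedSpokes-step k) (expectedSpokes-step k) ⟩
      D′ + D′                           ∎)
      where
      q = spokeProbability k
      D = expectedSpokes (toℕ k) (ℕ.<⇒≤ (Fin.toℕ<n k))
      D′ = expectedSpokes (suc (toℕ k)) (Fin.toℕ<n k)

    -- Tests `k` = 1 , ... , r in turn, and either stops at an unlikely spoke or accumulates 1/2 per
    -- step.
    search : ∀ r (r<p : r ℕ.< p) → Unlikely ⊎ ManySpokes (suc r) r<p
    search zero    0<p = inj₂ (≤-respˡ-≈ (+-identityˡ 0#) (+-mono-≤ 0≤D 0≤D))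
      where
      0≤D : 0# ≤ expectedSpokes 1 0<p
      0≤D = expected-nonNeg A I [] (requests 2 (s≤s 0<p)) λ S → 0≤fromℕ (spokeCount 2 S)
    search (suc r) r<p with search r (ℕ.<⇒≤ r<p)
    ... | inj₁ unlikely = inj₁ unlikely
    ... | inj₂ many     =
      -- `search-step` speaks of an element of `Fin p`; `Step` carries its statement over to the
      -- number `suc r`.
      subst Step (Fin.toℕ-fromℕ< r<p) (λ 1≤s _ → search-step (fromℕ< r<p) 1≤s) (s≤s z≤n) r<p many
      where
      Step : ℕ → Set ℓ₂
      Step s = 1 ℕ.≤ s → .(s<p : s ℕ.< p) → ManySpokes s (ℕ.<⇒≤ s<p) → Unlikely ⊎ ManySpokes (suc s) s<p

    expectedSpokes≤𝔼[maxDegree] : ∀ k →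
      expectedSpokes (suc (toℕ k)) (Fin.toℕ<n k) ≤ 𝔼[maxDegree] A I (sequence k)
    expectedSpokes≤𝔼[maxDegree] k = expected-mono A I [] (sequence k)
      {fromℕ ∘ spokeCount (2 ℕ.+ toℕ k)} {fromℕ ∘ maxDegree}
      λ S → fromℕ-mono-≤ {spokeCount (2 ℕ.+ toℕ k) S} {maxDegree S}
        (ℕ.≤-trans (spokeCount≤degree (2 ℕ.+ toℕ k) S) (degree≤maxDegree graph S zero))

    Hard : Set (κ ⊔ ℓ₁ ⊔ ℓ₂)
    Hard = Σ[ I ∈ Online.Instance K (2 ℕ.+ p) ] Σ[ σ ∈ List V ] Σ[ opt ∈ Carrier ]
      Online.Instance.IsOPT I σ opt × 0# < opt ×
      ((⅛ * fromℕ (2 ℕ.+ p)) * fromℕ (Online.Instance.bound I) ≤ 𝔼[maxDegree] A I σ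
        ⊎ (⅛ * fromℕ (2 ℕ.+ p)) * opt ≤ 𝔼[weight] A I σ)

    unlikely⇒hard : Unlikely → Hard
    unlikely⇒hard (k , 1≤k , 2q≤1) = I , sequence k , opt , isOPT , 0<opt , inj₂ (begin
      ⅛ * fromℕ (2 ℕ.+ p) * opt      ≈⟨ *-assoc ⅛ (fromℕ (2 ℕ.+ p)) opt ⟩
      ⅛ * (fromℕ (2 ℕ.+ p) * opt)
        ≤⟨ scale {fromℕ (2 ℕ.+ p) * opt} {𝔼[weight] A I (sequence k)} (heavy k)
        (heavy≤2𝔼[weight] k 2q≤1)
        (≤-trans n*opt≤heavy (fromℕ-mono-≤ {heavy k} {4 ℕ.* heavy k} (ℕ.m≤n*m (heavy k) 4))) ⟩
      𝔼[weight] A I (sequence k)     ∎)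
      where open Opt k 1≤k

    -- The expected degree of the root is at least k / 2, and the target n b / 8 = n / 4 is below
    -- this when 2 n ≤ 4 k.
    manySpokes⇒hard : ∀ k → 1 ℕ.≤ toℕ k → (2 ℕ.+ p) ℕ.* 2 ℕ.≤ 4 ℕ.* toℕ k →
                      ManySpokes (suc (toℕ k)) (Fin.toℕ<n k) → Hard
    manySpokes⇒hard k 1≤k 2n≤4k many = I , sequence k , opt , isOPT , 0<opt , inj₁ (begin
      ⅛ * fromℕ (2 ℕ.+ p) * fromℕ 2    ≈⟨ *-assoc ⅛ (fromℕ (2 ℕ.+ p)) (fromℕ 2) ⟩
      ⅛ * (fromℕ (2 ℕ.+ p) * fromℕ 2)  ≈⟨ *-congˡ (×1-homo-* (2 ℕ.+ p) 2) ⟨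
      ⅛ * fromℕ ((2 ℕ.+ p) ℕ.* 2)
        ≤⟨ scale {fromℕ ((2 ℕ.+ p) ℕ.* 2)} {𝔼[maxDegree] A I (sequence k)} (toℕ k)
        (≤-trans many (+-mono-≤ (expectedSpokes≤𝔼[maxDegree] k) (expectedSpokes≤𝔼[maxDegree] k)))
        (fromℕ-mono-≤ {(2 ℕ.+ p) ℕ.* 2} {4 ℕ.* toℕ k} 2n≤4k) ⟩
      𝔼[maxDegree] A I (sequence k)    ∎)
      where open Opt k 1≤k

    hard : ∀ k → 1 ℕ.≤ toℕ k → (2 ℕ.+ p) ℕ.* 2 ℕ.≤ 4 ℕ.* toℕ k → Hard
    hard k 1≤k 2n≤4k =
      [ unlikely⇒hard , manySpokes⇒hard k 1≤k 2n≤4k ]′ (search (toℕ k) (Fin.toℕ<n k))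

theorem3 : ∀ {k ℓ₁ ℓ₂} (K : LinearlyOrderedField k ℓ₁ ℓ₂) →
    let open LinearlyOrderedField K
        open Online K
        open Instance
    in
    Σ[ c ∈ Carrier ] 0# < c ×
      ((N : ℕ) → Σ[ n ∈ ℕ ] N ℕ.≤ n ×
        ((A : OnlineAlgorithm) →
          Σ[ I ∈ Instance n ] Σ[ σ ∈ List (Fin n) ] Σ[ opt ∈ Carrier ]
            IsOPT I σ opt × 0# < opt ×
            ((c * fromℕ n) * fromℕ (bound I) ≤ 𝔼[maxDegree] A I σ
              ⊎ (c * fromℕ n) * opt ≤ 𝔼[weight] A I σ)))
-- With p = 4 + N there are n = 6 + N vertices, and k = 3 + N is the last link, so the search may
-- reach the final terminal. Then 2 n = 12 + 2 N ≤ 12 + 4 N = 4 k, with equality at N = 0.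
theorem3 K = ⅛ , 0<⅛ , λ N → 2 ℕ.+ (4 ℕ.+ N) , ℕ.m≤n+m N 6 , λ A →
  LowerBound.Play.hard K (4 ℕ.+ N) A (Fin.fromℕ (3 ℕ.+ N)) (s≤s z≤n) (2n≤4k N)
  where
  open OneEighth K

  2n≤4k : ∀ N → (6 ℕ.+ N) ℕ.* 2 ℕ.≤ 4 ℕ.* toℕ (Fin.fromℕ (3 ℕ.+ N))
  2n≤4k N = begin
    (6 ℕ.+ N) ℕ.* 2                    ≤⟨ ℕ.*-monoˡ-≤ 2 (ℕ.+-monoʳ-≤ 6 (ℕ.m≤m*n N 2)) ⟩
    (3 ℕ.+ N) ℕ.* 2 ℕ.* 2              ≡⟨ ℕ.*-assoc (3 ℕ.+ N) 2 2 ⟩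
    (3 ℕ.+ N) ℕ.* 4                    ≡⟨ ℕ.*-comm (3 ℕ.+ N) 4 ⟩
    4 ℕ.* (3 ℕ.+ N)                    ≡⟨ cong (4 ℕ.*_) (Fin.toℕ-fromℕ (3 ℕ.+ N)) ⟨
    4 ℕ.* toℕ (Fin.fromℕ (3 ℕ.+ N))    ∎
    where open ℕ.≤-Reasoning
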